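{- Each of the two Celmins–Swart snarks $S_1$, $S_2$ (given by explicit edge lists in the context) has a planarizing perfect pseudo-matching. Explicitly, the perfect pseudo-matchings $M_1$ of $S_1$ and $M_2$ of $S_2$ given in the context are planarizing.
   Context: A perfect pseudo-matching $M$ in a graph $G$ is a collection of vertex-disjoint subgraphs of $G$, each isomorphic to $K_2$ or $K_{1,3}$, whose vertex sets together cover $V(G)$; $E(M)$ is the set of edges of its members. $G/M$ is the (multi)graph obtained by contracting each member of $M$ to a single vertex. $M$ is planarizing if $G/M$ is planar. Both graphs are cubic with vertex set $\{1,\dots,26\}$; the edge $\{i,j\}$ is written $i$-$j$. $S_1$: the edges of $M_1$ are $1$-$2$, $5$-$6$, $7$-$8$, $21$-$23$, $22$-$24$, $19$-$25$, $20$-$26$, and the three claws with center $14$ and leaves $9,10,18$; center $16$ and leaves $11,12,17$; center $13$ and leaves $3,4,15$. The remaining edges of $S_1$ are $1$-$4$, $2$-$3$, $5$-$10$, $6$-$9$, $8$-$11$, $7$-$12$, $3$-$10$, $4$-$11$, $5$-$21$, $9$-$23$, $8$-$22$, $12$-$24$, $1$-$6$, $2$-$7$, $23$-$25$, $25$-$26$, $24$-$26$, $18$-$21$, $18$-$19$, $17$-$20$, $17$-$22$, $15$-$20$, $15$-$19$. $S_2$: the edges of $M_2$ are $1$-$8$, $2$-$5$, $13$-$14$, $21$-$22$, $23$-$24$, and the four claws with center $4$ and leaves $3,6,7$; center $10$ and leaves $9,11,12$; center $18$ and leaves $16,25,26$; center $17$ and leaves $15,19,20$. The remaining edges of $S_2$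 are $1$-$3$, $2$-$3$, $6$-$8$, $1$-$20$, $8$-$21$, $5$-$7$, $2$-$26$, $5$-$23$, $22$-$24$, $19$-$21$, $19$-$25$, $23$-$25$, $20$-$22$, $24$-$26$, $6$-$9$, $7$-$11$, $9$-$13$, $11$-$14$, $12$-$15$, $12$-$16$, $14$-$15$, $13$-$16$. -}

module Defs where

open import Data.Fin.Base using (Fin; zero; suc; inject₁; fromℕ<)
open import Data.Fin using (#_)
import Data.Fin.Properties as Fin
open import Data.Fin.Subset using (Subset; _∈_; _∩_; Empty)
open import Data.Fin.Subset.Properties using (_∈?_)
open import Data.List.Base as List using (List; []; _∷_; _++_; length; map; filter; allFin; concat)
open import Data.List.Relation.Unary.All using (All)
open import Data.List.Relation.Unary.AllPairs using (AllPairs)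
open import Data.List.Relation.Unary.Any as Any using (Any; index)
import Data.List.Membership.DecPropositional as DecMembership
open import Data.Nat.Base as ℕ using (ℕ; suc)
import Data.Nat.Properties as ℕ
open import Data.Product.Base as Prod using (Σ; ∃; _×_; _,_; proj₁; proj₂; swap)
open import Data.Product.Properties using (≡-dec)
open import Data.Rational.Base as ℚ using (ℚ; 0ℚ; 1ℚ)
open import Data.Sum.Base using (_⊎_)
open import Data.Vec.Base as Vec using (Vec; _∷_; _∷ʳ_; fromList; tabulate)
open import Data.Vec.Properties using (lookup⇒[]=; lookup∘tabulate)
open import Function.Base using (_∘_)
open import Function.Bundles using (_↔_; Inverse)
open import Function.Definitions using (Injective)
open import Relation.Binary.PropositionalEquality using (_≡_; trans)
open import Relation.Nullary.Decidable using (Dec; True; does; toWitness; dec-true; ¬?; _×-dec_; _⊎-dec_)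

------------------------------------------------------------------------
-- Finite multigraphs

-- Edges are the positions in the list, so parallel edges and loops are
-- allowed. Each edge is unordered: the order in which its two ends are
-- listed carries no meaning.
record Multigraph : Set where
  field
    order : ℕ
    edges : List (Fin order × Fin order)

  Vertex : Set
  Vertex = Fin order

  Edge : Set
  Edge = Fin (length edges)

  ends : Edge → Vertex × Vertex
  ends = List.lookup edges

  _incidentTo_ : Vertex → Edge → Set
  v incidentTo e = v ≡ proj₁ (ends e) ⊎ v ≡ proj₂ (ends e)

  _incidentTo?_ : ∀ v e → Dec (v incidentTo e)
  v incidentTo? e = (v Fin.≟ proj₁ (ends e)) ⊎-dec (v Fin.≟ proj₂ (ends e))

open Multigraph using (order; edges; Vertex; Edge; ends)

record Subgraph (G : Multigraph) : Set where
  open Multigraph G using (_incidentTo_)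
  field
    vertexSet : Subset (order G)
    edgeSet   : Subset (length (edges G))
    closed    : ∀ {v e} → e ∈ edgeSet → v incidentTo e → v ∈ vertexSet

open Subgraph using (vertexSet; edgeSet)

record _≅_ {G : Multigraph} (H : Subgraph G) (K : Multigraph) : Set where
  field
    onVertices : Vertex K ↔ ∃ (_∈ vertexSet H)
    onEdges    : Edge K ↔ ∃ (_∈ edgeSet H)

  φ : Vertex K → Vertex G
  φ = proj₁ ∘ Inverse.to onVertices

  ψ : Edge K → Edge G
  ψ = proj₁ ∘ Inverse.to onEdges

  field
    preservesEnds : ∀ e → let uv = Prod.map φ φ (ends K e) in
                    ends G (ψ e) ≡ uv ⊎ ends G (ψ e) ≡ swap uv

K₂ : Multigraph
K₂ = record { order = 2 ; edges = (# 0 , # 1) ∷ [] }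

K₁,₃ : Multigraph
K₁,₃ = record
  { order = 4
  ; edges = (# 0 , # 1) ∷ (# 0 , # 2) ∷ (# 0 , # 3) ∷ []
  }

------------------------------------------------------------------------
-- Perfect pseudo-matchings and contraction

record IsPerfectPseudoMatching (G : Multigraph) (M : List (Subgraph G)) : Set where
  field
    members  : All (λ H → (H ≅ K₂) ⊎ (H ≅ K₁,₃)) M
    disjoint : AllPairs (λ H H′ → Empty (vertexSet H ∩ vertexSet H′)) M
    covers   : ∀ v → Any (λ H → v ∈ vertexSet H) M

  -- The position in M of the member containing v; it is the only one, by
  -- disjointness.
  memberOf : Vertex G → Fin (length M)
  memberOf v = index (covers v)

module _ {G : Multigraph} where

  -- e ∈E M says that e belongs to E(M).
  _∈E_ : Edge G → List (Subgraph G) → Set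
  e ∈E M = Any (λ H → e ∈ edgeSet H) M

  _∈E?_ : ∀ e M → Dec (e ∈E M)
  e ∈E? M = Any.any? (λ H → e ∈? edgeSet H) M

-- Since the members of M partition the vertices of G, the vertices of G/M are
-- the members of M. Only the edges of E(M) disappear: any other edge is kept,
-- possibly becoming a loop or parallel to another edge.
contract : (G : Multigraph) (M : List (Subgraph G)) →
           IsPerfectPseudoMatching G M → Multigraph
contract G M isPPM = record
  { order = length M
  ; edges = map (Prod.map memberOf memberOf ∘ ends G)
                (filter (λ e → ¬? (e ∈E? M)) (allFin (length (edges G))))
  }
  where open IsPerfectPseudoMatching isPPM using (memberOf)

------------------------------------------------------------------------
-- Planarity

-- A graph is planar when it can be drawn in the plane without crossings.
-- Edges are drawn here as polygonal arcs with rational corners. This is no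
-- restriction on finite graphs: the arcs of a plane drawing can be taken to be
-- polygonal, and their corners can then be moved to rational points.
-- Conversely, segments with rational endpoints that meet in ℝ² already meet in
-- ℚ², so a crossing-free drawing over ℚ is one over ℝ.

Point : Set
Point = ℚ × ℚ

-- (1 - t) p + t q
along : Point → Point → ℚ → Point
along (x , y) (x′ , y′) t = (1ℚ ℚ.- t) ℚ.* x ℚ.+ t ℚ.* x′
                          , (1ℚ ℚ.- t) ℚ.* y ℚ.+ t ℚ.* y′

record Drawing (G : Multigraph) : Set where
  field
    position : Vertex G → Point
    bends    : Edge G → List Point

  Segment : Edge G → Set
  Segment e = Fin (suc (length (bends e)))

  corners : (e : Edge G) → Vec Point (suc (suc (length (bends e))))
  corners e = position (proj₁ (ends G e))
            ∷ (fromList (bends e) ∷ʳ position (proj₂ (ends G e)))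

  -- The points of G seen as a one-dimensional complex: its vertices, and the
  -- interior points of its edges. An edge minus its last end is parametrised
  -- by a segment i and a t in [0,1); i = 0, t = 0 is its first end and
  -- is left out. No point is listed twice, and proofs are irrelevant, so _≡_ is
  -- equality of points of the complex.
  data PointOf : Set where
    vertex   : Vertex G → PointOf
    interior : (e : Edge G) (i : Segment e) (t : ℚ) →
               .(0ℚ ℚ.≤ t) → .(t ℚ.< 1ℚ) → .(i ≡ zero → 0ℚ ℚ.< t) → PointOf

  place : PointOf → Point
  place (vertex v)             = position v
  place (interior e i t _ _ _) =
    along (Vec.lookup (corners e) (inject₁ i)) (Vec.lookup (corners e) (suc i)) t

  -- Vertices are at distinct points, each edge is a simple arc (a simple closed
  -- curve, for a loop), and arcs meet each other and the vertices only at
  -- common ends.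
  CrossingFree : Set
  CrossingFree = Injective _≡_ _≡_ place

Planar : Multigraph → Set
Planar G = Σ (Drawing G) Drawing.CrossingFree

Planarizing : (G : Multigraph) (M : List (Subgraph G)) →
              IsPerfectPseudoMatching G M → Set
Planarizing G M isPPM = Planar (contract G M isPPM)

------------------------------------------------------------------------
-- Subgraphs given by their edges

-- The subgraph consisting of a set of edges and their ends.
edgeInduced : (G : Multigraph) → Subset (length (edges G)) → Subgraph G
edgeInduced G F = record
  { vertexSet = tabulate (λ v → does (isEnd? v))
  ; edgeSet   = F
  ; closed    = λ {v} {e} e∈F v∼e → lookup⇒[]= v _
      (trans (lookup∘tabulate _ v) (dec-true (isEnd? v) (e , e∈F , v∼e)))
  }
  where
  open Multigraph G using (_incidentTo_; _incidentTo?_)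

  isEnd? : ∀ v → Dec (∃ λ e → e ∈ F × v incidentTo e)
  isEnd? v = Fin.any? (λ e → (e ∈? F) ×-dec (v incidentTo? e))

-- The subgraph whose edges are those occurring (with the same order of ends) in
-- a given list.
fromEdgeList : (G : Multigraph) → List (Vertex G × Vertex G) → Subgraph G
fromEdgeList G es = edgeInduced G (tabulate (λ e → does (ends G e ∈ₗ? es)))
  where open DecMembership (≡-dec (Fin._≟_ {order G}) Fin._≟_)
          renaming (_∈?_ to _∈ₗ?_) using ()

------------------------------------------------------------------------
-- The Celmins–Swart snarks

-- The vertex called i, for i in {1,…,26}, is the element i - 1 of Fin 26.
vertexNo : (i : ℕ) {_ : True ((1 ℕ.≤? i) ×-dec (ℕ.pred i ℕ.<? 26))} → Fin 26
vertexNo (suc i) {inRange} = fromℕ< (proj₂ (toWitness inRange))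

infix 6 _─_

_─_ : (i j : ℕ) {_ : True ((1 ℕ.≤? i) ×-dec (ℕ.pred i ℕ.<? 26))}
      {_ : True ((1 ℕ.≤? j) ×-dec (ℕ.pred j ℕ.<? 26))} → Fin 26 × Fin 26
(i ─ j) {p} {q} = vertexNo i {p} , vertexNo j {q}

members₁ : List (List (Fin 26 × Fin 26))
members₁
  = (1 ─ 2 ∷ [])
  ∷ (5 ─ 6 ∷ [])
  ∷ (7 ─ 8 ∷ [])
  ∷ (21 ─ 23 ∷ [])
  ∷ (22 ─ 24 ∷ [])
  ∷ (19 ─ 25 ∷ [])
  ∷ (20 ─ 26 ∷ [])
  ∷ (14 ─ 9 ∷ 14 ─ 10 ∷ 14 ─ 18 ∷ [])
  ∷ (16 ─ 11 ∷ 16 ─ 12 ∷ 16 ─ 17 ∷ [])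
  ∷ (13 ─ 3 ∷ 13 ─ 4 ∷ 13 ─ 15 ∷ [])
  ∷ []

remaining₁ : List (Fin 26 × Fin 26)
remaining₁
  = 1 ─ 4 ∷ 2 ─ 3 ∷ 5 ─ 10 ∷ 6 ─ 9 ∷ 8 ─ 11 ∷ 7 ─ 12 ∷ 3 ─ 10 ∷ 4 ─ 11
  ∷ 5 ─ 21 ∷ 9 ─ 23 ∷ 8 ─ 22 ∷ 12 ─ 24 ∷ 1 ─ 6 ∷ 2 ─ 7 ∷ 23 ─ 25 ∷ 25 ─ 26
  ∷ 24 ─ 26 ∷ 18 ─ 21 ∷ 18 ─ 19 ∷ 17 ─ 20 ∷ 17 ─ 22 ∷ 15 ─ 20 ∷ 15 ─ 19 ∷ []

S₁ : Multigraph
S₁ = record { order = 26 ; edges = concat members₁ ++ remaining₁ }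

M₁ : List (Subgraph S₁)
M₁ = map (fromEdgeList S₁) members₁

members₂ : List (List (Fin 26 × Fin 26))
members₂
  = (1 ─ 8 ∷ [])
  ∷ (2 ─ 5 ∷ [])
  ∷ (13 ─ 14 ∷ [])
  ∷ (21 ─ 22 ∷ [])
  ∷ (23 ─ 24 ∷ [])
  ∷ (4 ─ 3 ∷ 4 ─ 6 ∷ 4 ─ 7 ∷ [])
  ∷ (10 ─ 9 ∷ 10 ─ 11 ∷ 10 ─ 12 ∷ [])
  ∷ (18 ─ 16 ∷ 18 ─ 25 ∷ 18 ─ 26 ∷ [])
  ∷ (17 ─ 15 ∷ 17 ─ 19 ∷ 17 ─ 20 ∷ [])
  ∷ []

remaining₂ : List (Fin 26 × Fin 26)
remaining₂
  = 1 ─ 3 ∷ 2 ─ 3 ∷ 6 ─ 8 ∷ 1 ─ 20 ∷ 8 ─ 21 ∷ 5 ─ 7 ∷ 2 ─ 26 ∷ 5 ─ 23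
  ∷ 22 ─ 24 ∷ 19 ─ 21 ∷ 19 ─ 25 ∷ 23 ─ 25 ∷ 20 ─ 22 ∷ 24 ─ 26 ∷ 6 ─ 9 ∷ 7 ─ 11
  ∷ 9 ─ 13 ∷ 11 ─ 14 ∷ 12 ─ 15 ∷ 12 ─ 16 ∷ 14 ─ 15 ∷ 13 ─ 16 ∷ []

S₂ : Multigraph
S₂ = record { order = 26 ; edges = concat members₂ ++ remaining₂ }

M₂ : List (Subgraph S₂)
M₂ = map (fromEdgeList S₂) members₂

{-# OPTIONS --safe #-}
module Submission where

-- Both quotients have straight-line drawings on a small grid, once one copy of
-- each doubled edge is given a bend. That a drawing has no crossings is a finite
-- check: cut it into its vertices and the segments of its edges (without the end
-- of each segment, and without the start of the first segment of each edge). Any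
-- two of these convex pieces are separated by an affine function that is
-- positive on one and at most 0 on the other, and a line through one of the
-- pieces, or perpendicular to it at an end, can be taken as the zero set. As an
-- affine function is determined on a segment by its values at the ends, only the
-- corners of the drawing have to be inspected.

open import Defs
open import Data.Bool.Base using (Bool; true; false)
import Data.Bool.Properties as Bool
open import Data.Fin using (#_)
open import Data.Fin.Base using (Fin; zero; suc; inject₁; cast)
import Data.Fin.Properties as Fin
open import Data.Fin.Subset using (Subset; _∈_; _∩_; Empty)
open import Data.Fin.Subset.Properties using (_∈?_; nonempty?)
open import Data.Integer.Base using (+_)
open import Data.List.Base as List using (List; []; _∷_; length)
open import Data.List.Properties using (length-map)
open import Data.List.Relation.Unary.All using ([]; _∷_)
open import Data.List.Relation.Unary.AllPairs using (AllPairs; allPairs?)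
open import Data.List.Relation.Unary.Any as Any using (Any; any?)
open import Data.List.Membership.Propositional using (lose)
open import Data.List.Membership.Propositional.Properties using (∈-lookup)
open import Data.Nat.Base using (ℕ)
open import Data.Product as Prod using (Σ-syntax; ∃; _×_; _,_; proj₁; proj₂; swap)
open import Data.Product.Properties using (≡-dec; ,-injectiveˡ; ,-injectiveʳ)
open import Data.Rational.Base as ℚ using (ℚ; 0ℚ; 1ℚ; _+_; _*_; -_; _-_; _≤_; _<_)
open import Data.Rational.Literals using (fromℤ)
import Data.Rational.Properties as ℚ
open import Data.Rational.Solver using (module +-*-Solver)
open import Data.Sum.Base using (_⊎_; inj₁; inj₂)
open import Data.Vec.Base as Vec using (Vec; []; _∷_)
open import Data.Vec.Properties.WithK using ([]=-irrelevant)
open import Function.Base using (_∘_)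
open import Function.Bundles using (_↔_; mk↔ₛ′)
open import Relation.Binary.Definitions using (DecidableEquality)
open import Relation.Binary.PropositionalEquality
open import Relation.Nullary.Decidable using (Dec; yes; no; does; recompute; map′; ¬?; _×-dec_; _⊎-dec_; _→-dec_)
open import Relation.Nullary.Negation using (¬_; contradiction)

open Multigraph using (order; edges; Vertex; Edge; ends)
open Subgraph using (vertexSet; edgeSet)

-- Unlike toWitness: checking does a? ≡ true by refl evaluates a? several times
-- faster than checking True a?.
witness : ∀ {a} {A : Set a} (a? : Dec A) → does a? ≡ true → A
witness (yes a) _ = a

-- Affine functions on segments

mix : ℚ → ℚ → ℚ → ℚ
mix x y t = (1ℚ - t) * x + t * y

<⇒≱ : ∀ {p q} → p < q → ¬ q ≤ p
<⇒≱ p<q q≤p = ℚ.<-irrefl refl (ℚ.<-≤-trans p<q q≤p)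

0<1-t : ∀ {t} → t < 1ℚ → 0ℚ < 1ℚ - t
0<1-t {t} t<1 = subst (_< 1ℚ - t) (ℚ.+-inverseʳ t) (ℚ.+-monoˡ-< (- t) t<1)

0<* : ∀ {x y} → 0ℚ < x → 0ℚ < y → 0ℚ < x * y
0<* {x} {y} 0<x 0<y = subst (_< x * y) (ℚ.*-zeroʳ x)
  (ℚ.*-monoʳ-<-pos x {{ℚ.positive 0<x}} 0<y)

0≤* : ∀ {x y} → 0ℚ ≤ x → 0ℚ ≤ y → 0ℚ ≤ x * y
0≤* {x} {y} 0≤x 0≤y = subst (_≤ x * y) (ℚ.*-zeroʳ x)
  (ℚ.*-monoˡ-≤-nonNeg x {{ℚ.nonNegative 0≤x}} 0≤y)

*≤0 : ∀ {x y} → 0ℚ ≤ x → y ≤ 0ℚ → x * y ≤ 0ℚ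
*≤0 {x} {y} 0≤x y≤0 = subst (x * y ≤_) (ℚ.*-zeroʳ x)
  (ℚ.*-monoˡ-≤-nonNeg x {{ℚ.nonNegative 0≤x}} y≤0)

mix-injective : ∀ {x y t t′} → x ≢ y → mix x y t ≡ mix x y t′ → t ≡ t′
mix-injective {x} {y} {t} {t′} x≢y eq =
  trans (recover t) (trans (cong (λ z → (z - x) * 1/d) eq) (sym (recover t′)))
  where
  instance
    d≢0 : ℚ.NonZero (y - x)
    d≢0 = ℚ.≢-nonZero λ y-x≡0 → x≢y (sym (x∙y⁻¹≈ε⇒x≈y y x y-x≡0))
      where open import Algebra.Properties.Group ℚ.+-0-group
  1/d : ℚ
  1/d = ℚ.1/ (y - x)
  open ≡-Reasoning
  -- The linear equation is solved for the parameter: `s` is `mix x y s - x` divided by the nonzero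
  -- `y - x`.
  recover : ∀ s → s ≡ (mix x y s - x) * 1/d
  recover s = begin
    s                          ≡⟨ ℚ.*-identityʳ s ⟨
    s * 1ℚ                     ≡⟨ cong (s *_) (ℚ.*-inverseʳ (y - x)) ⟨
    s * ((y - x) * 1/d)        ≡⟨ solve 4 (λ s x y i →
                                    s :* ((y :- x) :* i)
                                    := ((con 1ℚ :- s) :* x :+ s :* y :- x) :* i)
                                  refl s x y 1/d ⟩
    (mix x y s - x) * 1/d      ∎
    where open +-*-Solver

-- (a , b) , (x₀ , y₀) stands for the function a (x - x₀) + b (y - y₀).
Affine : Set
Affine = Point × Point

infix 7 _·_

_·_ : Affine → Point → ℚ
((a , b) , (x₀ , y₀)) · (x , y) = a * (x - x₀) + b * (y - y₀)

-- The weights `1 - t` and `t` add up to 1, so the constant term of `f` is preserved.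
·-along : ∀ f p q t → f · along p q t ≡ mix (f · p) (f · q) t
·-along ((a , b) , (x₀ , y₀)) (x , y) (x′ , y′) t =
  solve 9 (λ a b x₀ y₀ x y x′ y′ t →
      a :* ((con 1ℚ :- t) :* x :+ t :* x′ :- x₀) :+ b :* ((con 1ℚ :- t) :* y :+ t :* y′ :- y₀)
      := (con 1ℚ :- t) :* (a :* (x :- x₀) :+ b :* (y :- y₀)) :+ t :* (a :* (x′ :- x₀) :+ b :* (y′ :- y₀)))
    refl a b x₀ y₀ x y x′ y′ t
  where open +-*-Solver

-- Convex pieces and their separation

-- The segment from start to stop without stop, and without start unless
-- hasStart; a single point is the piece with stop = start.
record Piece : Set where
  constructor piece
  field
    hasStart   : Bool
    start stop : Point

open Piece

ParameterOf : Piece → ℚ → Set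
ParameterOf A t = 0ℚ ≤ t × t < 1ℚ × (hasStart A ≡ false → 0ℚ < t)

at : Piece → ℚ → Point
at A = along (start A) (stop A)

-- As `t < 1`, the start always has positive weight. The stop is sure to have it only when `t = 0`
-- is excluded, hence the condition on `hasStart` in the second case.
Positive NonPositive : Affine → Piece → Set
Positive f A = (0ℚ < f · start A × 0ℚ ≤ f · stop A)
             ⊎ (hasStart A ≡ false × 0ℚ ≤ f · start A × 0ℚ < f · stop A)
NonPositive f A = f · start A ≤ 0ℚ × f · stop A ≤ 0ℚ

positive? : ∀ f A → Dec (Positive f A)
positive? f A =
  ((0ℚ ℚ.<? f · start A) ×-dec (0ℚ ℚ.≤? f · stop A))
  ⊎-dec ((hasStart A Bool.≟ false) ×-dec (0ℚ ℚ.≤? f · start A) ×-dec (0ℚ ℚ.<? f · stop A))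

nonPositive? : ∀ f A → Dec (NonPositive f A)
nonPositive? f A = (f · start A ℚ.≤? 0ℚ) ×-dec (f · stop A ℚ.≤? 0ℚ)

positive-at : ∀ {f A t} → Positive f A → ParameterOf A t → 0ℚ < f · at A t
positive-at {f} {A} {t} pos (0≤t , t<1 , open⇒0<t) =
  subst (0ℚ <_) (sym (·-along f (start A) (stop A) t)) (go pos)
  where
  go : Positive f A → 0ℚ < mix (f · start A) (f · stop A) t
  go (inj₁ (0<p , 0≤q)) =
    ℚ.+-mono-<-≤ (0<* (0<1-t t<1) 0<p) (0≤* 0≤t 0≤q)
  go (inj₂ (isOpen , 0≤p , 0<q)) =
    ℚ.+-mono-≤-< (0≤* (ℚ.<⇒≤ (0<1-t t<1)) 0≤p) (0<* (open⇒0<t isOpen) 0<q)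

nonPositive-at : ∀ {f A t} → NonPositive f A → ParameterOf A t → f · at A t ≤ 0ℚ
nonPositive-at {f} {A} {t} (p≤0 , q≤0) (0≤t , t<1 , _) =
  subst (_≤ 0ℚ) (sym (·-along f (start A) (stop A) t))
    (ℚ.+-mono-≤ (*≤0 (ℚ.<⇒≤ (0<1-t t<1)) p≤0) (*≤0 0≤t q≤0))

-- The two sides of the line of B, the half-planes that A enters at its start
-- and leaves at its stop, and, for two single points, the half-plane at B
-- towards A.
candidates : Piece → Piece → List Affine
candidates (piece _ p@(x , y) q@(x′ , y′)) (piece _ r@(u , v) (u′ , v′))
  = ((v - v′ , u′ - u) , r)
  ∷ ((v′ - v , u - u′) , r)
  ∷ ((x′ - x , y′ - y) , p)
  ∷ ((x - x′ , y - y′) , q)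
  ∷ ((x - u , y - v) , r)
  ∷ []

Above : Piece → Piece → Set
Above A B = Any (λ f → Positive f A × NonPositive f B) (candidates A B)

above? : ∀ A B → Dec (Above A B)
above? A B = any? (λ f → positive? f A ×-dec nonPositive? f B) (candidates A B)

-- `candidates` treats its two pieces differently, so both orders are tried.
Separated : Piece → Piece → Set
Separated A B = Above A B ⊎ Above B A

separated? : ∀ A B → Dec (Separated A B)
separated? A B = above? A B ⊎-dec above? B A

above⇒disjoint : ∀ {A B s t} → Above A B → ParameterOf A s → ParameterOf B t → at A s ≢ at B t
above⇒disjoint {A} {B} above s∈ t∈ eq with f , positive , nonPositive ← Any.satisfied above =
  <⇒≱ (positive-at {f} {A} positive s∈)
      (subst (λ p → f · p ≤ 0ℚ) (sym eq) (nonPositive-at {f} {B} nonPositive t∈))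

separated⇒disjoint : ∀ {A B s t} → Separated A B → ParameterOf A s → ParameterOf B t → at A s ≢ at B t
separated⇒disjoint {A} {B} (inj₁ above) s∈ t∈ eq = above⇒disjoint {A} {B} above s∈ t∈ eq
separated⇒disjoint {A} {B} (inj₂ below) s∈ t∈ eq = above⇒disjoint {B} {A} below t∈ s∈ (sym eq)

-- Distinct ends differ in some coordinate, and that coordinate determines the parameter.
along-injective : ∀ {p q t t′} → p ≢ q → along p q t ≡ along p q t′ → t ≡ t′
along-injective {x , y} {x′ , y′} p≢q eq with x ℚ.≟ x′ | y ℚ.≟ y′
... | no x≢x′ | _       = mix-injective x≢x′ (,-injectiveˡ eq)
... | yes _   | no y≢y′ = mix-injective y≢y′ (,-injectiveʳ eq)
... | yes refl | yes refl = contradiction refl p≢q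

along-start : ∀ p q → along p q 0ℚ ≡ p
along-start (x , y) (x′ , y′) = cong₂ _,_ (first x x′) (first y y′)
  where
  open +-*-Solver
  first : ∀ x y → mix x y 0ℚ ≡ x
  first = solve 2 (λ x y → (con 1ℚ :- con 0ℚ) :* x :+ con 0ℚ :* y := x) refl

-- Crossing-free drawings

module _ {G : Multigraph} (D : Drawing G) where
  open Drawing D

  data Cell : Set where
    vertex  : Vertex G → Cell
    segment : (e : Edge G) → Segment e → Cell

  all-cells? : {P : Cell → Set} → (∀ c → Dec (P c)) → Dec (∀ c → P c)
  all-cells? P? = map′
    (λ { (pv , ps) → λ { (vertex v) → pv v ; (segment e i) → ps e i } })
    (λ p → p ∘ vertex , λ e i → p (segment e i))
    (Fin.all? (P? ∘ vertex) ×-dec Fin.all? λ e → Fin.all? λ i → P? (segment e i))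

  _≟ᶜ_ : DecidableEquality Cell
  vertex v    ≟ᶜ vertex w     = map′ (cong vertex) (λ { refl → refl }) (v Fin.≟ w)
  vertex _    ≟ᶜ segment _ _  = no λ ()
  segment _ _ ≟ᶜ vertex _     = no λ ()
  segment e i ≟ᶜ segment e′ j = map′ (λ { refl → refl }) (λ { refl → refl })
    (≡-dec Fin._≟_ Fin._≟_ (e , i) (e′ , j))

  segmentPiece : (e : Edge G) → Segment e → Bool → Piece
  segmentPiece e i b = piece b (Vec.lookup (corners e) (inject₁ i)) (Vec.lookup (corners e) (suc i))

  -- A bend belongs to the segment that it starts, whereas the first end of an edge belongs to the
  -- cell of its vertex.
  pieceOf : Cell → Piece
  pieceOf (vertex v)            = piece true (position v) (position v)
  pieceOf (segment e zero)      = segmentPiece e zero false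
  pieceOf (segment e i@(suc _)) = segmentPiece e i true

  PiecesSeparated : Set
  PiecesSeparated =
    (∀ e i → Vec.lookup (corners e) (inject₁ i) ≢ Vec.lookup (corners e) (suc i))
    × (∀ c d → c ≢ d → Separated (pieceOf c) (pieceOf d))

  piecesSeparated? : Dec PiecesSeparated
  piecesSeparated? =
    (Fin.all? λ e → Fin.all? λ i →
      ¬? (≡-dec ℚ._≟_ ℚ._≟_ (Vec.lookup (corners e) (inject₁ i)) (Vec.lookup (corners e) (suc i))))
    ×-dec
    (all-cells? λ c → all-cells? λ d → ¬? (c ≟ᶜ d) →-dec separated? (pieceOf c) (pieceOf d))

  cellOf : PointOf → Cell
  cellOf (vertex v)             = vertex v
  cellOf (interior e i _ _ _ _) = segment e i

  parameter : PointOf → ℚ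
  -- The piece of a vertex has its start, which is the point at parameter 0.
  parameter (vertex _)             = 0ℚ
  parameter (interior _ _ t _ _ _) = t

  parameter-valid : ∀ x → ParameterOf (pieceOf (cellOf x)) (parameter x)
  parameter-valid (vertex v) = ℚ.≤-refl , ℚ.positive⁻¹ 1ℚ , λ ()
  -- The bounds stored in a point are irrelevant; deciding them again makes them usable.
  parameter-valid (interior e zero t 0≤t t<1 0<t) =
    recompute (0ℚ ℚ.≤? t) 0≤t , recompute (t ℚ.<? 1ℚ) t<1 , λ _ → recompute (0ℚ ℚ.<? t) (0<t refl)
  parameter-valid (interior e (suc i) t 0≤t t<1 _) =
    recompute (0ℚ ℚ.≤? t) 0≤t , recompute (t ℚ.<? 1ℚ) t<1 , λ ()

  place-at : ∀ x → place x ≡ at (pieceOf (cellOf x)) (parameter x)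
  place-at (vertex v)                   = sym (along-start (position v) (position v))
  place-at (interior e zero t _ _ _)    = refl
  place-at (interior e (suc i) t _ _ _) = refl

  -- Points of different cells are kept apart by separation, and points of one segment by
  -- injectivity of its parametrisation.
  piecesSeparated⇒crossingFree : PiecesSeparated → CrossingFree
  piecesSeparated⇒crossingFree (proper , apart) {x} {y} eq with cellOf x ≟ᶜ cellOf y
  ... | no c≢d = contradiction (trans (sym (place-at x)) (trans eq (place-at y)))
                   (separated⇒disjoint (apart _ _ c≢d) (parameter-valid x) (parameter-valid y))
  ... | yes c≡d = sameCell x y c≡d eq
    where
    sameCell : ∀ x y → cellOf x ≡ cellOf y → place x ≡ place y → x ≡ y
    sameCell (vertex v) (vertex .v) refl _ = refl
    sameCell (interior e i t _ _ _) (interior .e .i t′ _ _ _) refl eq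
      -- The remaining arguments of `interior` are irrelevant, so equal parameters give equal
      -- points.
      with refl ← along-injective {t = t} {t′} (proper e i) eq = refl

-- Subgraphs isomorphic to a given multigraph

Enumerates : ∀ {m n} → (Fin m → Fin n) → Subset n → Set
Enumerates f p = (∀ i → f i ∈ p)
               × (∀ x → x ∈ p → ∃ λ i → f i ≡ x)
               × (∀ i j → f i ≡ f j → i ≡ j)

enumerates? : ∀ {m n} (f : Fin m → Fin n) (p : Subset n) → Dec (Enumerates f p)
enumerates? f p = (Fin.all? λ i → f i ∈? p)
  ×-dec (Fin.all? λ x → (x ∈? p) →-dec Fin.any? λ i → f i Fin.≟ x)
  ×-dec (Fin.all? λ i → Fin.all? λ j → (f i Fin.≟ f j) →-dec (i Fin.≟ j))

enumerates⇒↔ : ∀ {m n} {f : Fin m → Fin n} {p : Subset n} → Enumerates f p → Fin m ↔ ∃ (_∈ p)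
enumerates⇒↔ {f = f} {p} (f∈p , onto , inj) = mk↔ₛ′
  (λ i → f i , f∈p i)
  (λ (x , x∈p) → proj₁ (onto x x∈p))
  (λ (x , x∈p) → ∃-≡ (proj₂ (onto x x∈p)))
  (λ i → inj _ _ (proj₂ (onto (f i) (f∈p i))))
  where
  -- Membership in a subset has at most one proof.
  ∃-≡ : ∀ {x y} {x∈p : x ∈ p} {y∈p : y ∈ p} → x ≡ y → (x , x∈p) ≡ (y , y∈p)
  ∃-≡ refl = cong (_ ,_) ([]=-irrelevant _ _)

module _ {G : Multigraph} (H : Subgraph G) (K : Multigraph)
         (φ : Vec (Vertex G) (order K)) (ψ : Vec (Edge G) (length (edges K))) where

  IsIsomorphism : Set
  IsIsomorphism =
    Enumerates (Vec.lookup φ) (vertexSet H) × Enumerates (Vec.lookup ψ) (edgeSet H) ×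
    (∀ e → let uv = Prod.map (Vec.lookup φ) (Vec.lookup φ) (ends K e) in
           ends G (Vec.lookup ψ e) ≡ uv ⊎ ends G (Vec.lookup ψ e) ≡ swap uv)

  isIsomorphism? : Dec IsIsomorphism
  isIsomorphism? =
    enumerates? (Vec.lookup φ) (vertexSet H) ×-dec enumerates? (Vec.lookup ψ) (edgeSet H)
    ×-dec Fin.all? λ e → ≡-dec Fin._≟_ Fin._≟_ _ _ ⊎-dec ≡-dec Fin._≟_ Fin._≟_ _ _

  isomorphism : IsIsomorphism → H ≅ K
  isomorphism (onV , onE , preserves) = record
    { onVertices    = enumerates⇒↔ onV
    ; onEdges       = enumerates⇒↔ onE
    ; preservesEnds = preserves
    }

module _ {G : Multigraph} (H : Subgraph G) where

  private
    tail head : Edge G → Vertex G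
    tail = proj₁ ∘ ends G
    head = proj₂ ∘ ends G

  edgeEnds : Edge G → Vec (Vertex G) 2
  edgeEnds e = tail e ∷ head e ∷ []

  -- The edges of a claw are listed centre first, so its centre is `tail e`; it is put first to
  -- match vertex 0 of `K₁,₃`.
  clawEnds : Edge G → Edge G → Edge G → Vec (Vertex G) 4
  clawEnds e f g = tail e ∷ head e ∷ head f ∷ head g ∷ []

  edge : ∀ e → does (isIsomorphism? H K₂ (edgeEnds e) (e ∷ [])) ≡ true → H ≅ K₂ ⊎ H ≅ K₁,₃
  edge e ok = inj₁ (isomorphism H K₂ (edgeEnds e) (e ∷ [])
                     (witness (isIsomorphism? H K₂ (edgeEnds e) (e ∷ [])) ok))

  claw : ∀ e f g → does (isIsomorphism? H K₁,₃ (clawEnds e f g) (e ∷ f ∷ g ∷ [])) ≡ true →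
         H ≅ K₂ ⊎ H ≅ K₁,₃
  claw e f g ok = inj₂ (isomorphism H K₁,₃ (clawEnds e f g) (e ∷ f ∷ g ∷ [])
                         (witness (isIsomorphism? H K₁,₃ (clawEnds e f g) (e ∷ f ∷ g ∷ [])) ok))

-- The two perfect pseudo-matchings

disjoint? : ∀ {G} (M : List (Subgraph G)) →
            Dec (AllPairs (λ H H′ → Empty (vertexSet H ∩ vertexSet H′)) M)
disjoint? = allPairs? λ H H′ → ¬? (nonempty? (vertexSet H ∩ vertexSet H′))

-- The covering members are tabulated because the edges of the quotient are
-- computed from their positions, which are slow to extract from a search.
covers : ∀ {G} (M : List (Subgraph G)) (t : Vec (Fin (length M)) (order G)) →
         does (Fin.all? λ v → v ∈? vertexSet (List.lookup M (Vec.lookup t v))) ≡ true →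
         ∀ v → Any (λ H → v ∈ vertexSet H) M
covers M t ok v = lose (∈-lookup (Vec.lookup t v))
  (witness (Fin.all? λ v → v ∈? vertexSet (List.lookup M (Vec.lookup t v))) ok v)

memberTable₁ : Vec (Fin (length M₁)) 26
memberTable₁
  = # 0 ∷ # 0 ∷ # 9 ∷ # 9 ∷ # 1 ∷ # 1 ∷ # 2 ∷ # 2 ∷ # 7 ∷ # 7 ∷ # 8 ∷ # 8 ∷ # 9
  ∷ # 7 ∷ # 9 ∷ # 8 ∷ # 8 ∷ # 7 ∷ # 5 ∷ # 6 ∷ # 3 ∷ # 4 ∷ # 3 ∷ # 4 ∷ # 5 ∷ # 6 ∷ []

isPPM₁ : IsPerfectPseudoMatching S₁ M₁
isPPM₁ = record
  -- The edge list of `S₁` starts with the edges of the members, in order, at positions 0 to 15.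
  { members  = edge _ (# 0) refl
             ∷ edge _ (# 1) refl
             ∷ edge _ (# 2) refl
             ∷ edge _ (# 3) refl
             ∷ edge _ (# 4) refl
             ∷ edge _ (# 5) refl
             ∷ edge _ (# 6) refl
             ∷ claw _ (# 7) (# 8) (# 9) refl
             ∷ claw _ (# 10) (# 11) (# 12) refl
             ∷ claw _ (# 13) (# 14) (# 15) refl ∷ []
  ; disjoint = witness (disjoint? M₁) refl
  ; covers   = covers M₁ memberTable₁ refl
  }

memberTable₂ : Vec (Fin (length M₂)) 26
memberTable₂
  = # 0 ∷ # 1 ∷ # 5 ∷ # 5 ∷ # 1 ∷ # 5 ∷ # 5 ∷ # 0 ∷ # 6 ∷ # 6 ∷ # 6 ∷ # 6 ∷ # 2
  ∷ # 2 ∷ # 8 ∷ # 7 ∷ # 8 ∷ # 7 ∷ # 8 ∷ # 8 ∷ # 3 ∷ # 3 ∷ # 4 ∷ # 4 ∷ # 7 ∷ # 7 ∷ []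

isPPM₂ : IsPerfectPseudoMatching S₂ M₂
isPPM₂ = record
  { members  = edge _ (# 0) refl
             ∷ edge _ (# 1) refl
             ∷ edge _ (# 2) refl
             ∷ edge _ (# 3) refl
             ∷ edge _ (# 4) refl
             ∷ claw _ (# 5) (# 6) (# 7) refl
             ∷ claw _ (# 8) (# 9) (# 10) refl
             ∷ claw _ (# 11) (# 12) (# 13) refl
             ∷ claw _ (# 14) (# 15) (# 16) refl ∷ []
  ; disjoint = witness (disjoint? M₂) refl
  ; covers   = covers M₂ memberTable₂ refl
  }

-- Drawings of the two quotients

⟨_,_⟩ : ℕ → ℕ → Point
⟨ x , y ⟩ = fromℤ (+ x) , fromℤ (+ y)

DrawnEdge : ℕ → Set
DrawnEdge n = Fin n × Fin n × List Point

joined : ∀ {n} → DrawnEdge n → Fin n × Fin n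
joined (u , v , _) = u , v

underlying : ∀ {n} → List (DrawnEdge n) → Multigraph
underlying {n} es = record { order = n ; edges = List.map joined es }

drawing : ∀ {n} → Vec Point n → (es : List (DrawnEdge n)) → Drawing (underlying es)
drawing ps es = record
  { position = Vec.lookup ps
  -- An edge is a position in the mapped list; `cast` turns it into a position in `es`.
  ; bends    = λ e → proj₂ (proj₂ (List.lookup es (cast (length-map joined es) e)))
  }

planar : ∀ {n} (ps : Vec Point n) (es : List (DrawnEdge n)) →
         does (piecesSeparated? (drawing ps es)) ≡ true → Planar (underlying es)
planar ps es ok =
  drawing ps es , piecesSeparated⇒crossingFree (drawing ps es)
    (witness (piecesSeparated? (drawing ps es)) ok)

positions₁ : Vec Point 10
positions₁
  = ⟨ 1 , 5 ⟩ ∷ ⟨ 5 , 4 ⟩ ∷ ⟨ 0 , 2 ⟩ ∷ ⟨ 5 , 2 ⟩ ∷ ⟨ 0 , 1 ⟩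
  ∷ ⟨ 4 , 0 ⟩ ∷ ⟨ 3 , 0 ⟩ ∷ ⟨ 3 , 3 ⟩ ∷ ⟨ 1 , 2 ⟩ ∷ ⟨ 3 , 1 ⟩ ∷ []

-- The edges of the quotient, in the order in which contract lists them; vertex i
-- is the i-th member of the pseudo-matching, counted from 0.
drawnEdges₁ : List (DrawnEdge 10)
drawnEdges₁
  = (# 0 , # 9 , [])
  ∷ (# 0 , # 9 , ⟨ 2 , 2 ⟩ ∷ [])
  ∷ (# 1 , # 7 , [])
  ∷ (# 1 , # 7 , ⟨ 2 , 4 ⟩ ∷ [])
  ∷ (# 2 , # 8 , [])
  ∷ (# 2 , # 8 , ⟨ 1 , 4 ⟩ ∷ [])
  ∷ (# 9 , # 7 , [])
  ∷ (# 9 , # 8 , [])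
  ∷ (# 1 , # 3 , [])
  ∷ (# 7 , # 3 , [])
  ∷ (# 2 , # 4 , [])
  ∷ (# 8 , # 4 , [])
  ∷ (# 0 , # 1 , [])
  ∷ (# 0 , # 2 , [])
  ∷ (# 3 , # 5 , [])
  ∷ (# 5 , # 6 , [])
  ∷ (# 4 , # 6 , [])
  ∷ (# 7 , # 3 , ⟨ 4 , 3 ⟩ ∷ [])
  ∷ (# 7 , # 5 , [])
  ∷ (# 8 , # 6 , [])
  ∷ (# 8 , # 4 , ⟨ 1 , 1 ⟩ ∷ [])
  ∷ (# 9 , # 6 , [])
  ∷ (# 9 , # 5 , [])
  ∷ []

positions₂ : Vec Point 9
positions₂
  = ⟨ 2 , 1 ⟩ ∷ ⟨ 4 , 4 ⟩ ∷ ⟨ 3 , 1 ⟩ ∷ ⟨ 0 , 3 ⟩ ∷ ⟨ 4 , 5 ⟩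
  ∷ ⟨ 3 , 3 ⟩ ∷ ⟨ 4 , 3 ⟩ ∷ ⟨ 5 , 0 ⟩ ∷ ⟨ 2 , 0 ⟩ ∷ []

drawnEdges₂ : List (DrawnEdge 9)
drawnEdges₂
  = (# 0 , # 5 , [])
  ∷ (# 1 , # 5 , [])
  ∷ (# 5 , # 0 , ⟨ 1 , 3 ⟩ ∷ [])
  ∷ (# 0 , # 8 , [])
  ∷ (# 0 , # 3 , [])
  ∷ (# 1 , # 5 , ⟨ 3 , 4 ⟩ ∷ [])
  ∷ (# 1 , # 7 , [])
  ∷ (# 1 , # 4 , [])
  ∷ (# 3 , # 4 , [])
  ∷ (# 8 , # 3 , [])
  ∷ (# 8 , # 7 , [])
  ∷ (# 4 , # 7 , [])
  ∷ (# 8 , # 3 , ⟨ 0 , 2 ⟩ ∷ [])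
  ∷ (# 4 , # 7 , ⟨ 5 , 5 ⟩ ∷ [])
  ∷ (# 5 , # 6 , [])
  ∷ (# 5 , # 6 , ⟨ 3 , 2 ⟩ ∷ [])
  ∷ (# 6 , # 2 , [])
  ∷ (# 6 , # 2 , ⟨ 4 , 2 ⟩ ∷ [])
  ∷ (# 6 , # 8 , [])
  ∷ (# 6 , # 7 , [])
  ∷ (# 2 , # 8 , [])
  ∷ (# 2 , # 7 , [])
  ∷ []

mainTheorem5 :
    (Σ[ isPPM ∈ IsPerfectPseudoMatching S₁ M₁ ] Planarizing S₁ M₁ isPPM)
    × (Σ[ isPPM ∈ IsPerfectPseudoMatching S₂ M₂ ] Planarizing S₂ M₂ isPPM)
-- The contracted graph evaluates to `underlying drawnEdges₁`, and `refl` runs the separation check;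
-- likewise for the second snark.
mainTheorem5 = (isPPM₁ , planar positions₁ drawnEdges₁ refl)
             , (isPPM₂ , planar positions₂ drawnEdges₂ refl)
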